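{- For any dynamically-consistent (multi-head, integer weighted) CHyTN $\Gamma=\langle V,\mathcal{A},L,\mathcal{O},\mathcal{O}V,P\rangle$, where $V$ is the set of events and $\Sigma_P$ is the set of scenarios, it holds that $$\hat\epsilon(\Gamma)\ge|\Sigma_P|^{ -1}|V|^{ -1}.$$
   Context: Labels. Let $P$ be a finite set of boolean variables. A label is a (possibly empty) conjunction of literals over $P$; $P^*$ is the set of all labels and $\lambda$ is the empty label. $\mathrm{Sub}(\ell_1,\ell_2)$ ("$\ell_1$ subsumes $\ell_2$") means $\ell_1\Rightarrow\ell_2$ holds. CHyTN. A (multi-head) Conditional Hyper Temporal Network (CHyTN) is a tuple $\Gamma=\langle V,\mathcal{A},L,\mathcal{O},\mathcal{O}V,P\rangle$ where $V$ is a finite nonempty set of events; $P$ a finite set of boolean variables; $L:V\to P^*$; $\mathcal{O}V\subseteq V$ is the set of observation events; $\mathcal{O}:P\to\mathcal{O}V$ is a bijection, $\mathcal{O}_p:=\mathcal{O}(p)$; and $\mathcal{A}$ is a finite set of labeled hyper constraints $A=(t_A,H_A,w_A,L_{H_A})$ with tail $t_A\in V$, nonempty set of heads $H_A\subseteq V\setminus\{t_A\}$, integer weights $w_A:H_A\to\mathbb{Z}$, and labels $L_{H_A}:H_A\to P^*$ (a constraint with one head $h$, weight $w$ and label $\ell$ is called standard and is also written $\langle h-t_A\le w,\ell\rangle$). It must satisfy: (WD1') each $L_{H_A}(h)$ is satisfiable and subsumes $L(t_A)$ and $L(h)$; (WD2) whenever $p$ or $\neg p$ appears in $L(u)$, $\mathrm{Sub}(L(u),L(\mathcal{O}_p))$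 and the standard constraint $\langle\mathcal{O}_p-u\le-\epsilon_0,L(u)\rangle$ is in $\mathcal{A}$ for some $\epsilon_0>0$ (an integer, since weights are integers); (WD3') whenever $p$ or $\neg p$ appears in some $L_{H_A}(h)$, $\mathrm{Sub}(L_{H_A}(h),L(\mathcal{O}_p))$. Scenarios and strategies. A scenario is a map $s:P\to\{\top,\bot\}$; $\Sigma_P$ is the set of scenarios; $s(\ell)$ is the truth value of $\ell$ under $s$. $V^+_s=\{v\in V:s(L(v))=\top\}$, $V^+_{s_1,s_2}=V^+_{s_1}\cap V^+_{s_2}$. The restriction $\mathcal{A}^+_s$ consists of the hyperarcs $(t_A,H'_A,w_A|_{H'_A})$, $A\in\mathcal{A}$, where $H'_A=\{h\in H_A:s(L_{H_A}(h))=\top\}$ is nonempty. An execution strategy $\sigma$ assigns to each $s\in\Sigma_P$ a schedule $\sigma(s):V^+_s\to\mathbb{R}$, values written $[\sigma(s)]_v$. It is viable if for every $s$ and every $(t,H,w)\in\mathcal{A}^+_s$, $[\sigma(s)]_t\ge\min_{v\in H}\{[\sigma(s)]_v-w(v)\}$. Dynamic consistency. $\mathrm{scHst}(v,s,\sigma)=\{(p,s(p)):p\in P,\ \mathcal{O}_p\in V^+_s,\ [\sigma(s)]_{\mathcal{O}_p}<[\sigma(s)]_v\}$; $\mathrm{Con}(\mathrm{scHst}(v,s_1,\sigma),s_2)$ means $s_2(p)=s_1(p)$ for every $p$ occurring in it. $\sigma$ is dynamic if for all $s_1,s_2\in\Sigma_P$ and $v\in V^+_{s_1,s_2}$: $\mathrm{Con}(\mathrm{scHst}(v,s_1,\sigma),s_2)\Rightarrow[\sigma(s_1)]_v=[\sigma(s_2)]_v$.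 $\Gamma$ is dynamically-consistent if it admits a viable and dynamic execution strategy. $\epsilon$-dynamic consistency. $\Delta(s_1;s_2)=\{\mathcal{O}_p\in V^+_{s_1}: s_1(p)\ne s_2(p)\}$. For real $\epsilon>0$, $\sigma$ is $\epsilon$-dynamic if for all $s_1,s_2\in\Sigma_P$ and $u\in V^+_{s_1,s_2}$: $[\sigma(s_1)]_u\ge\min\big(\{[\sigma(s_2)]_u\}\cup\{[\sigma(s_1)]_v+\epsilon: v\in\Delta(s_1;s_2)\}\big)$. $\Gamma$ is $\epsilon$-dynamically-consistent if it admits a viable and $\epsilon$-dynamic execution strategy. Reaction time. $\hat\epsilon(\Gamma)=\sup\{\epsilon>0:\Gamma\text{ is }\epsilon\text{ -dynamically-consistent}\}$, taken in the extended reals (with $\sup\emptyset=-\infty$). -}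

module Defs where

open import Data.Bool using (Bool; true; not; T; _∧_)
open import Data.Bool.Properties using (T?)
import Data.Bool.Properties as Bool
open import Data.Fin using (Fin)
open import Data.Fin.Properties using (*↔×; 2↔Bool)
open import Data.Fin.Subset using (Subset; _∈_; _∉_; Nonempty; ⁅_⁆)
open import Data.Fin.Subset.Properties using (_∈?_)
open import Data.Integer as ℤ using (ℤ; +_)
open import Data.List using (List; []; _∷_; map; mapMaybe; foldr; allFin)
open import Data.List.Membership.Propositional using () renaming (_∈_ to _∈ˡ_)
open import Data.List.NonEmpty using (List⁺; _∷_; foldr₁)
open import Data.List.Relation.Binary.BagAndSetEquality using (_∼[_]_; set)
import Data.Maybe as Maybe
open import Data.Nat as ℕ using (ℕ; suc; NonZero; _^_)
import Data.Nat.Properties as ℕ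
open import Data.Product using (Σ; ∃; ∃-syntax; _×_; _,_; proj₁; proj₂)
open import Data.Product.Function.NonDependent.Propositional using (_×-↔_)
open import Data.Rational as ℚ using (ℚ; 0ℚ; ½; ∣_∣)
import Data.Rational.Properties as ℚ
open import Data.Rational.Solver using (module +-*-Solver)
open import Data.Sum using (inj₁; inj₂; _⊎_)
open import Data.Vec as Vec using (Vec; lookup)
open import Function.Bundles using (_⤖_; _↔_; mk↔ₛ′; module Bijection)
open import Function.Properties.Inverse using (↔-sym; ↔-trans)
open import Relation.Binary.Construct.Add.Extrema.NonStrict as Extrema using ()
open import Relation.Binary.PropositionalEquality
  using (_≡_; refl; sym; trans; cong; subst)
open import Relation.Nullary using (¬_; ¬?)
open import Relation.Nullary.Construct.Add.Extrema using (_±; [_])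
open import Relation.Nullary.Decidable using (dec⇒maybe; _×-dec_)
open import Relation.Unary using (Pred; Decidable)

-- ℝ is a setoid: Cauchy sequences of rationals up to _≈_.

IsCauchy : (ℕ → ℚ) → Set
IsCauchy x = ∀ ε → 0ℚ ℚ.< ε →
  ∃[ N ] ∀ m n → N ℕ.≤ m → N ℕ.≤ n → ∣ x m ℚ.- x n ∣ ℚ.< ε

record ℝ : Set where
  constructor mkℝ
  field
    seq    : ℕ → ℚ
    cauchy : IsCauchy seq

open ℝ

infix 4 _<_ _≤_ _≈_

_<_ : ℝ → ℝ → Set
x < y = ∃[ δ ] 0ℚ ℚ.< δ × ∃[ N ] ∀ n → N ℕ.≤ n → seq x n ℚ.+ δ ℚ.≤ seq y n

_≤_ : ℝ → ℝ → Set
x ≤ y = ¬ (y < x)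

_≈_ : ℝ → ℝ → Set
x ≈ y = x ≤ y × y ≤ x

private
  half-pos : ∀ {ε} → 0ℚ ℚ.< ε → 0ℚ ℚ.< ½ ℚ.* ε
  half-pos {ε} 0<ε =
    subst (ℚ._< ½ ℚ.* ε) (ℚ.*-zeroʳ ½) (ℚ.*-monoʳ-<-pos ½ 0<ε)

  half+half : ∀ ε → ½ ℚ.* ε ℚ.+ ½ ℚ.* ε ≡ ε
  half+half ε = trans (sym (ℚ.*-distribʳ-+ ε ½ ½)) (ℚ.*-identityˡ ε)

  p≤∣p∣ : ∀ p → p ℚ.≤ ∣ p ∣
  p≤∣p∣ p with ℚ.≤-total 0ℚ p
  ... | inj₁ 0≤p = ℚ.≤-reflexive (sym (ℚ.0≤p⇒∣p∣≡p 0≤p))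
  ... | inj₂ p≤0 = ℚ.≤-trans p≤0 (ℚ.0≤∣p∣ p)

  ∣a-b∣≡∣b-a∣ : ∀ a b → ∣ a ℚ.- b ∣ ≡ ∣ b ℚ.- a ∣
  ∣a-b∣≡∣b-a∣ a b = trans (sym (ℚ.∣-p∣≡∣p∣ (a ℚ.- b)))
    (cong ∣_∣ (solve 2 (λ a b → :- (a :- b) := b :- a) refl a b))
    where open +-*-Solver

  ∣a-b∣<ε⇒a<b+ε : ∀ {a b ε} → ∣ a ℚ.- b ∣ ℚ.< ε → a ℚ.< b ℚ.+ ε
  ∣a-b∣<ε⇒a<b+ε {a} {b} h =
    subst (ℚ._< _) (solve 2 (λ a b → b :+ (a :- b) := a) refl a b)
      (ℚ.+-monoʳ-< b (ℚ.≤-<-trans (p≤∣p∣ (a ℚ.- b)) h))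
    where open +-*-Solver

  a<b+ε⇒a-b<ε : ∀ {a b ε} → a ℚ.< b ℚ.+ ε → a ℚ.- b ℚ.< ε
  a<b+ε⇒a-b<ε {a} {b} {ε} h =
    subst (a ℚ.- b ℚ.<_) (solve 2 (λ b ε → b :+ ε :- b := ε) refl b ε)
      (ℚ.+-monoˡ-< (ℚ.- b) h)
    where open +-*-Solver

  close : ∀ {a b ε} → a ℚ.< b ℚ.+ ε → b ℚ.< a ℚ.+ ε → ∣ a ℚ.- b ∣ ℚ.< ε
  close {a} {b} {ε} h k with ℚ.∣p∣≡p∨∣p∣≡-p (a ℚ.- b)
  ... | inj₁ eq = subst (ℚ._< ε) (sym eq) (a<b+ε⇒a-b<ε h)
  ... | inj₂ eq = subst (ℚ._< ε) (sym (trans eq neg)) (a<b+ε⇒a-b<ε k)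
    where
    open +-*-Solver
    neg : ℚ.- (a ℚ.- b) ≡ b ℚ.- a
    neg = solve 2 (λ a b → :- (a :- b) := b :- a) refl a b

  ⊓-<+ : ∀ {a b c d ε} → a ℚ.< c ℚ.+ ε → b ℚ.< d ℚ.+ ε →
         a ℚ.⊓ b ℚ.< c ℚ.⊓ d ℚ.+ ε
  ⊓-<+ {a} {b} {c} {d} {ε} h k with ℚ.⊓-sel c d
  ... | inj₁ eq = subst (λ z → a ℚ.⊓ b ℚ.< z ℚ.+ ε) (sym eq)
                    (ℚ.≤-<-trans (ℚ.p⊓q≤p a b) h)
  ... | inj₂ eq = subst (λ z → a ℚ.⊓ b ℚ.< z ℚ.+ ε) (sym eq)
                    (ℚ.≤-<-trans (ℚ.p⊓q≤q a b) k)

fromℚ : ℚ → ℝ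
fromℚ q = mkℝ (λ _ → q) λ ε 0<ε →
  0 , λ _ _ _ _ → subst (ℚ._< ε) (cong ∣_∣ (sym (ℚ.+-inverseʳ q))) 0<ε

fromℤ : ℤ → ℝ
fromℤ z = fromℚ (z ℚ./ 1)

0ℝ : ℝ
0ℝ = fromℚ 0ℚ

infixl 6 _+_ _-_
infixl 7 _⊓_
infix 8 -_

_+_ : ℝ → ℝ → ℝ
x + y = mkℝ (λ n → seq x n ℚ.+ seq y n) λ ε 0<ε →
  let M , hM = cauchy x (½ ℚ.* ε) (half-pos 0<ε)
      N , hN = cauchy y (½ ℚ.* ε) (half-pos 0<ε)
  in M ℕ.⊔ N , λ m n hm hn →
     subst (ℚ._< ε)
       (cong ∣_∣ (regroup (seq x m) (seq x n) (seq y m) (seq y n)))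
       (ℚ.≤-<-trans
         (ℚ.∣p+q∣≤∣p∣+∣q∣ (seq x m ℚ.- seq x n) (seq y m ℚ.- seq y n))
         (subst (_ ℚ.<_) (half+half ε)
           (ℚ.+-mono-< (hM m n (ℕ.m⊔n≤o⇒m≤o M N hm) (ℕ.m⊔n≤o⇒m≤o M N hn))
                       (hN m n (ℕ.m⊔n≤o⇒n≤o M N hm) (ℕ.m⊔n≤o⇒n≤o M N hn)))))
  where
  open +-*-Solver
  regroup : ∀ a b c d → (a ℚ.- b) ℚ.+ (c ℚ.- d) ≡ (a ℚ.+ c) ℚ.- (b ℚ.+ d)
  regroup = solve 4
    (λ a b c d → (a :- b) :+ (c :- d) := (a :+ c) :- (b :+ d)) refl

-_ : ℝ → ℝ
- x = mkℝ (λ n → ℚ.- seq x n) λ ε 0<ε →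
  let N , hN = cauchy x ε 0<ε
  in N , λ m n hm hn →
     subst (ℚ._< ε) (cong ∣_∣ (flip (seq x n) (seq x m))) (hN n m hn hm)
  where
  open +-*-Solver
  flip : ∀ a b → a ℚ.- b ≡ (ℚ.- b) ℚ.- (ℚ.- a)
  flip = solve 2 (λ a b → a :- b := (:- b) :- (:- a)) refl

_-_ : ℝ → ℝ → ℝ
x - y = x + (- y)

_⊓_ : ℝ → ℝ → ℝ
x ⊓ y = mkℝ (λ n → seq x n ℚ.⊓ seq y n) λ ε 0<ε →
  let M , hM = cauchy x ε 0<ε
      N , hN = cauchy y ε 0<ε
      near = λ m n hm hn →
        ⊓-<+ {seq x m} {seq y m} {seq x n} {seq y n}
          (∣a-b∣<ε⇒a<b+ε (hM m n (ℕ.m⊔n≤o⇒m≤o M N hm) (ℕ.m⊔n≤o⇒m≤o M N hn)))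
          (∣a-b∣<ε⇒a<b+ε (hN m n (ℕ.m⊔n≤o⇒n≤o M N hm) (ℕ.m⊔n≤o⇒n≤o M N hn)))
  in M ℕ.⊔ N , λ m n hm hn → close (near m n hm hn) (near n m hn hm)

min : List⁺ ℝ → ℝ
min = foldr₁ _⊓_

open Extrema _≤_ public using (_≤±_)

-- The supremum is a relation, since a bounded predicate on ℝ need not have a
-- constructively definable least upper bound.  Over ℝ ± the supremum of the
-- empty predicate is ⊥±.
IsSupremum : Pred ℝ _ → ℝ ± → Set
IsSupremum S e = UpperBound e × (∀ b → UpperBound b → e ≤± b)
  where
  UpperBound : ℝ ± → Set
  UpperBound b = ∀ x → S x → [ x ] ≤± b

-- Throughout, V = Fin n and P = Fin p.

data Literal (p : ℕ) : Set where
  pos neg : Fin p → Literal p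

Label : ℕ → Set
Label p = List (Literal p)

Scenario : ℕ → Set
Scenario p = Vec Bool p

-- |Σ_P| = 2 ^ p
Scenario↔Fin : ∀ p → Scenario p ↔ Fin (2 ^ p)
Scenario↔Fin 0 = mk↔ₛ′ (λ _ → Fin.zero) (λ _ → Vec.[])
  (λ { Fin.zero → refl ; (Fin.suc ()) }) (λ { Vec.[] → refl })
Scenario↔Fin (suc p) =
  ↔-trans (mk↔ₛ′ (λ s → Vec.head s , Vec.tail s) (λ (b , s) → b Vec.∷ s)
                 (λ _ → refl) (λ { (_ Vec.∷ _) → refl }))
  (↔-trans (↔-sym 2↔Bool ×-↔ Scenario↔Fin p) (↔-sym *↔×))

infix 9 _⟦_⟧ˡ _⟦_⟧

_⟦_⟧ˡ : ∀ {p} → Scenario p → Literal p → Bool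
s ⟦ pos x ⟧ˡ = lookup s x
s ⟦ neg x ⟧ˡ = not (lookup s x)

_⟦_⟧ : ∀ {p} → Scenario p → Label p → Bool
s ⟦ ℓ ⟧ = foldr (λ l b → s ⟦ l ⟧ˡ ∧ b) true ℓ

Satisfiable : ∀ {p} → Label p → Set
Satisfiable ℓ = ∃[ s ] T (s ⟦ ℓ ⟧)

Sub : ∀ {p} → Label p → Label p → Set
Sub ℓ₁ ℓ₂ = ∀ s → T (s ⟦ ℓ₁ ⟧) → T (s ⟦ ℓ₂ ⟧)

_AppearsIn_ : ∀ {p} → Fin p → Label p → Set
x AppearsIn ℓ = pos x ∈ˡ ℓ ⊎ neg x ∈ˡ ℓ

record HyperConstraint (n p : ℕ) : Set where
  field
    tail      : Fin n
    heads     : Subset n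
    nonempty  : Nonempty heads
    tail∉     : tail ∉ heads
    weight    : ∀ {h} → h ∈ heads → ℤ
    headLabel : ∀ {h} → h ∈ heads → Label p

-- A is the standard constraint ⟨ h − t ≤ w , ℓ ⟩; labels are compared as
-- sets of literals.
IsStandard : ∀ {n p} → HyperConstraint n p → Fin n → Fin n → ℤ → Label p → Set
IsStandard A h t w ℓ =
  tail ≡ t × heads ≡ ⁅ h ⁆ ×
  (∀ {x} (x∈ : x ∈ heads) → weight x∈ ≡ w × headLabel x∈ ∼[ set ] ℓ)
  where open HyperConstraint A

record CHyTN (n p : ℕ) .{{_ : NonZero n}} : Set where
  open HyperConstraint
  field
    𝒜  : List (HyperConstraint n p)
    L  : Fin n → Label p
    𝒪V : Subset n
    𝒪  : Fin p ⤖ ∃ (_∈ 𝒪V)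

  obs : Fin p → Fin n
  obs x = proj₁ (Bijection.to 𝒪 x)

  field
    wd1 : ∀ {A} → A ∈ˡ 𝒜 → ∀ {h} (h∈ : h ∈ heads A) →
          Satisfiable (headLabel A h∈) ×
          Sub (headLabel A h∈) (L (tail A)) ×
          Sub (headLabel A h∈) (L h)
    wd2 : ∀ u x → x AppearsIn L u →
          Sub (L u) (L (obs x)) ×
          ∃[ ε₀ ] + 0 ℤ.< ε₀ ×
          ∃[ A ] A ∈ˡ 𝒜 × IsStandard A (obs x) u (ℤ.- ε₀) (L u)
    wd3 : ∀ {A} → A ∈ˡ 𝒜 → ∀ {h} (h∈ : h ∈ heads A) →
          ∀ x → x AppearsIn headLabel A h∈ →
          Sub (headLabel A h∈) (L (obs x))

select : ∀ {a q} {A : Set a} {Q : Pred A q} → Decidable Q → List A → List (Σ A Q)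
select Q? = mapMaybe (λ x → Maybe.map (x ,_) (dec⇒maybe (Q? x)))

module _ {n p} .{{_ : NonZero n}} (Γ : CHyTN n p) where
  open CHyTN Γ
  open HyperConstraint

  infix 4 _∈V⁺_

  _∈V⁺_ : Fin n → Scenario p → Set
  v ∈V⁺ s = T (s ⟦ L v ⟧)

  V⁺ : Scenario p → Set
  V⁺ s = ∃ (_∈V⁺ s)

  Strategy : Set
  Strategy = ∀ s → V⁺ s → ℝ

  ActiveHead : HyperConstraint n p → Scenario p → Set
  ActiveHead A s = Σ (∃ (_∈ heads A)) λ (h , h∈) → T (s ⟦ headLabel A h∈ ⟧)

  activeHeads : ∀ A s → List (ActiveHead A s)
  activeHeads A s =
    select (λ (h , h∈) → T? (s ⟦ headLabel A h∈ ⟧))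
      (select (_∈? heads A) (allFin n))

  -- By wd1, the head and the tail of an active hyperarc are both executed.
  head⁺ : ∀ {A s} → A ∈ˡ 𝒜 → ActiveHead A s → V⁺ s
  head⁺ {s = s} A∈ ((h , h∈) , t) = h , proj₂ (proj₂ (wd1 A∈ h∈)) s t

  tail⁺ : ∀ {A s} → A ∈ˡ 𝒜 → ActiveHead A s → V⁺ s
  tail⁺ {A} {s} A∈ ((_ , h∈) , t) = tail A , proj₁ (proj₂ (wd1 A∈ h∈)) s t

  -- Quantifying over A ∈ 𝒜 whose list of active heads is a cons is the same
  -- as quantifying over the hyperarcs of the restriction of 𝒜 to s.
  Viable : Strategy → Set
  Viable σ = ∀ s {A} (A∈ : A ∈ˡ 𝒜) {h hs} → activeHeads A s ≡ h ∷ hs →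
    let cost = λ (a : ActiveHead A s) →
          σ s (head⁺ {A} A∈ a) - fromℤ (weight A (proj₂ (proj₁ a)))
    in min (cost h ∷ map cost hs) ≤ σ s (tail⁺ {A} A∈ h)

  scHst : ∀ {s} → V⁺ s → Strategy → Pred (Fin p × Bool) _
  scHst {s} v σ (x , b) =
    b ≡ lookup s x × Σ (obs x ∈V⁺ s) λ o → σ s (obs x , o) < σ s v

  Con : Pred (Fin p × Bool) _ → Scenario p → Set
  Con H s = ∀ x b → H (x , b) → lookup s x ≡ b

  Dynamic : Strategy → Set
  Dynamic σ = ∀ s₁ s₂ v (v₁ : v ∈V⁺ s₁) (v₂ : v ∈V⁺ s₂) →
    Con (scHst {s₁} (v , v₁) σ) s₂ → σ s₁ (v , v₁) ≈ σ s₂ (v , v₂)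

  DynamicallyConsistent : Set
  DynamicallyConsistent = ∃[ σ ] Viable σ × Dynamic σ

  Δ : ∀ s₁ (s₂ : Scenario p) → List (V⁺ s₁)
  Δ s₁ s₂ = map (λ (x , o , _) → obs x , o)
    (select (λ x → T? (s₁ ⟦ L (obs x) ⟧) ×-dec
                   ¬? (lookup s₁ x Bool.≟ lookup s₂ x))
            (allFin p))

  EpsilonDynamic : ℝ → Strategy → Set
  EpsilonDynamic ε σ = ∀ s₁ s₂ u (u₁ : u ∈V⁺ s₁) (u₂ : u ∈V⁺ s₂) →
    min (σ s₂ (u , u₂) ∷ map (λ v → σ s₁ v + ε) (Δ s₁ s₂)) ≤ σ s₁ (u , u₁)

  EpsilonDynamicallyConsistent : ℝ → Set
  EpsilonDynamicallyConsistent ε = ∃[ σ ] Viable σ × EpsilonDynamic ε σ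

  -- ε̂(Γ) = e
  IsReactionTime : ℝ ± → Set
  IsReactionTime =
    IsSupremum (λ ε → 0ℝ < ε × EpsilonDynamicallyConsistent ε)

1/[∣Σ∣*∣V∣] : (n p : ℕ) .{{_ : NonZero n}} → ℝ
1/[∣Σ∣*∣V∣] n p = fromℚ ((+ 1 ℚ./ (2 ^ p ℕ.* n)) {{ℕ.m*n≢0 (2 ^ p) n {{ℕ.m^n≢0 2 p}}}})

-- Let a₁, …, a_N be all the values σ(s)(v) of a viable and dynamic strategy σ
-- (0 where v is not executed under s), N = |Σ_P| |V|.  Replace aᵢ by the average
-- bᵢ = (1/N) Σⱼ ⌊aᵢ - aⱼ⌋.  Each summand shifts with integer translations of aᵢ, so
-- aₗ - w ≤ aᵢ implies bₗ - w ≤ bᵢ for integers w: viability and equalities survive.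
-- If aᵢ < aₗ, the summand at j = l is negative for i and zero for l, so
-- bᵢ + 1/N ≤ bₗ: the new strategy is 1/N-dynamic.
-- Floors of reals exist only up to double negation, which suffices since the
-- conclusion is a negative statement.
module Submission where

open import Defs
open import Data.Bool.Properties using (T?; T-irrelevant)
import Data.Bool.Properties as Bool
open import Data.Fin using (Fin; zero; suc)
open import Data.Fin.Properties using (*↔×; sequence)
open import Data.Integer as ℤ using (ℤ; +_; 0ℤ; 1ℤ)
import Data.Integer.Properties as ℤ
import Data.Integer.Solver as ℤ-Solver
open import Data.List using ([]; _∷_; map; allFin)
open import Data.List.Membership.Propositional using () renaming (_∈_ to _∈ˡ_)
open import Data.List.Membership.Propositional.Properties using (∈-allFin)
open import Data.List.NonEmpty using (_∷_)
open import Data.List.Relation.Unary.Any as Any using (Any; here; there)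
import Data.List.Relation.Unary.Any.Properties as Any
open import Data.Nat as ℕ using (ℕ; zero; suc; NonZero; _^_)
import Data.Nat.Properties as ℕ
open import Data.Product using (∃; ∃-syntax; _×_; _,_; proj₁; proj₂)
open import Data.Product.Function.NonDependent.Propositional using (_×-↔_)
open import Data.Rational as ℚ using (mkℚ; 0ℚ; 1ℚ; ∣_∣)
import Data.Rational.Properties as ℚ
open import Data.Rational.Solver using (module +-*-Solver)
import Data.Rational.Unnormalised as ℚᵘ
import Data.Rational.Unnormalised.Properties as ℚᵘ
open import Data.Sum using (_⊎_; inj₁; inj₂; [_,_]′)
open import Data.Vec using (lookup)
open import Data.Vec.Functional using (Vector; head; tail)
open import Effect.Monad using (RawMonad)
open import Function.Base using (_∘_; case_of_; id)
open import Function.Bundles using (_↔_; module Inverse)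
open import Function.Construct.Identity using (↔-id)
open import Function.Properties.Inverse using (↔-sym; ↔-trans)
open import Relation.Binary.Construct.Add.Extrema.NonStrict _≤_ using ([_]; [_]≤⊤±; [≤]-injective)
import Relation.Binary.Construct.Add.Supremum.NonStrict as Sup
open import Relation.Binary.PropositionalEquality
  using (_≡_; refl; sym; trans; cong; subst; subst₂)
open import Relation.Nullary using (¬_; ¬?; yes; no; contradiction)
open import Relation.Nullary.Construct.Add.Extrema using (_±; [_]; ⊥±; ⊤±)
open import Relation.Nullary.Decidable using (¬¬-excluded-middle; decidable-stable; _×-dec_)
open import Relation.Nullary.Negation using (¬¬-Monad; ¬¬-map)
open import Relation.Unary using (Pred; Decidable)
open import Algebra.Properties.Monoid.Sum ℤ.+-0-monoid using (sum)
open import Algebra.Properties.Group ℚ.+-0-group using (inverseˡ-unique)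

open ℝ
open +-*-Solver using (solve; _:+_; _:-_; _:*_; :-_; _:=_; con)

-- Order on Cauchy reals.

p≤∣p∣ : ∀ p → p ℚ.≤ ∣ p ∣
p≤∣p∣ p with ℚ.≤-total 0ℚ p
... | inj₁ 0≤p = ℚ.≤-reflexive (sym (ℚ.0≤p⇒∣p∣≡p 0≤p))
... | inj₂ p≤0 = ℚ.≤-trans p≤0 (ℚ.0≤∣p∣ p)

p≤q+∣p-q∣ : ∀ p q → p ℚ.≤ q ℚ.+ ∣ p ℚ.- q ∣
p≤q+∣p-q∣ p q =
  subst (ℚ._≤ q ℚ.+ ∣ p ℚ.- q ∣) (solve 2 (λ p q → q :+ (p :- q) := p) refl p q)
    (ℚ.+-monoʳ-≤ q (p≤∣p∣ (p ℚ.- q)))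

p+q≤r⇒q≤r-p : ∀ p q r → p ℚ.+ q ℚ.≤ r → q ℚ.≤ r ℚ.- p
p+q≤r⇒q≤r-p p q r h =
  subst (ℚ._≤ r ℚ.- p) (solve 2 (λ p q → p :+ q :- p := q) refl p q)
    (ℚ.+-monoˡ-≤ (ℚ.- p) h)

q≤r-p⇒p+q≤r : ∀ p q r → q ℚ.≤ r ℚ.- p → p ℚ.+ q ℚ.≤ r
q≤r-p⇒p+q≤r p q r h =
  subst (p ℚ.+ q ℚ.≤_) (solve 2 (λ p r → p :+ (r :- p) := r) refl p r)
    (ℚ.+-monoʳ-≤ p h)

-- The witnesses `δ` and `N` carry over, since `x < y` says that `seq y k - seq x k` is eventually
-- at least `δ`. Rearrangements of strict inequalities between reals thus reduce to facts about
-- rational terms.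
<-by-difference : ∀ x y x′ y′ →
  (∀ k → seq y k ℚ.- seq x k ℚ.≤ seq y′ k ℚ.- seq x′ k) → x < y → x′ < y′
<-by-difference x y x′ y′ h (δ , 0<δ , N , x+δ≤y) = δ , 0<δ , N , λ k N≤k →
  q≤r-p⇒p+q≤r (seq x′ k) δ (seq y′ k)
    (ℚ.≤-trans (p+q≤r⇒q≤r-p (seq x k) δ (seq y k) (x+δ≤y k N≤k)) (h k))

<-≡-difference : ∀ x y x′ y′ →
  (∀ k → seq y k ℚ.- seq x k ≡ seq y′ k ℚ.- seq x′ k) → x < y → x′ < y′
<-≡-difference x y x′ y′ h = <-by-difference x y x′ y′ (ℚ.≤-reflexive ∘ h)

<-irrefl : ∀ x → ¬ (x < x)
<-irrefl x (δ , 0<δ , N , h) = ℚ.<-irrefl refl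
  (ℚ.<-≤-trans (subst (ℚ._< seq x N ℚ.+ δ) (ℚ.+-identityʳ _) (ℚ.+-monoʳ-< (seq x N) 0<δ))
               (h N ℕ.≤-refl))

<-trans : ∀ x y z → x < y → y < z → x < z
<-trans x y z (δ , 0<δ , M , h) (δ′ , 0<δ′ , N , h′) = δ , 0<δ , M ℕ.⊔ N , λ k k≥ →
  ℚ.≤-trans (h k (ℕ.m⊔n≤o⇒m≤o M N k≥)) (ℚ.≤-trans
    (subst (ℚ._≤ seq y k ℚ.+ δ′) (ℚ.+-identityʳ (seq y k)) (ℚ.+-monoʳ-≤ (seq y k) (ℚ.<⇒≤ 0<δ′)))
    (h′ k (ℕ.m⊔n≤o⇒n≤o M N k≥)))

fromℚ-mono-< : ∀ {p q} → p ℚ.< q → fromℚ p < fromℚ q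
fromℚ-mono-< {p} {q} p<q = q ℚ.- p ,
  subst (ℚ._< q ℚ.- p) (ℚ.+-inverseʳ p) (ℚ.+-monoˡ-< (ℚ.- p) p<q) ,
  0 , λ _ _ → ℚ.≤-reflexive (solve 2 (λ p q → p :+ (q :- p) := q) refl p q)

fromℚ-cancel-< : ∀ {p q} → fromℚ p < fromℚ q → p ℚ.< q
fromℚ-cancel-< {p} {q} (δ , 0<δ , N , h) = ℚ.<-≤-trans
  (subst (ℚ._< p ℚ.+ δ) (ℚ.+-identityʳ p) (ℚ.+-monoʳ-< p 0<δ)) (h N ℕ.≤-refl)

private
  -- Past `M` the terms of `x` rise by at most `e` and those of `z` fall by at most `e`, so a
  -- distance of `3e` at `M` leaves `e` at every later index.
  gap : ∀ x z e M → 0ℚ ℚ.< e →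
    (∀ k → M ℕ.≤ k → seq x k ℚ.≤ seq x M ℚ.+ e) →
    (∀ k → M ℕ.≤ k → seq z M ℚ.≤ seq z k ℚ.+ e) →
    seq x M ℚ.+ (e ℚ.+ e ℚ.+ e) ℚ.≤ seq z M → x < z
  gap x z e M 0<e hx hz h = e , 0<e , M , λ k M≤k →
    q≤r-p⇒p+q≤r (seq x k) e (seq z k) (ℚ.≤-trans (ℚ.≤-reflexive (lhs (seq x M) e))
      (ℚ.+-mono-≤
        (p≤q+r⇒p-r≤q {q = seq z k} (ℚ.≤-trans h (hz k M≤k)))
        (ℚ.neg-antimono-≤ (hx k M≤k))))
    where
    lhs : ∀ a e → e ≡ a ℚ.+ (e ℚ.+ e ℚ.+ e) ℚ.- e ℚ.+ ℚ.- (a ℚ.+ e)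
    lhs = solve 2 (λ a e → e := a :+ (e :+ e :+ e) :- e :+ (:- (a :+ e))) refl
    p≤q+r⇒p-r≤q : ∀ {p q r} → p ℚ.≤ q ℚ.+ r → p ℚ.- r ℚ.≤ q
    p≤q+r⇒p-r≤q {p} {q} {r} h =
      subst (p ℚ.- r ℚ.≤_) (solve 2 (λ q r → q :+ r :- r := q) refl q r)
        (ℚ.+-monoˡ-≤ (ℚ.- r) h)

-- A single rational comparison at an index `M` past all moduli decides. With `e = δ/6`, the terms
-- of `x` and `y` are at least `6e` apart at `M`, so `z` is `3e` above `x` or `3e` below `y`. As
-- `_≤_` is a negation, mixed transitivity of `_<_` and `_≤_` rests on this.
<-cotrans : ∀ x y z → x < y → x < z ⊎ z < y
<-cotrans x y z (δ , 0<δ , N , x+δ≤y) =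
  case ℚ.≤-total (seq x M ℚ.+ (e ℚ.+ e ℚ.+ e)) (seq z M) of λ where
    (inj₁ h) → inj₁ (gap x z e M 0<e (above x ≤M₁) (below z ≤M₃) h)
    (inj₂ h) → inj₂ (gap z y e M 0<e (above z ≤M₃) (below y ≤M₂)
      (ℚ.≤-trans (ℚ.+-monoˡ-≤ _ h)
        (ℚ.≤-trans (ℚ.≤-reflexive (split (seq x M) δ)) (x+δ≤y M ≤M₀))))
  where
  sixth = + 1 ℚ./ 6
  e = sixth ℚ.* δ
  0<e : 0ℚ ℚ.< e
  0<e = subst (ℚ._< e) (ℚ.*-zeroʳ sixth) (ℚ.*-monoʳ-<-pos sixth 0<δ)
  split : ∀ a δ → let e = sixth ℚ.* δ in
    a ℚ.+ (e ℚ.+ e ℚ.+ e) ℚ.+ (e ℚ.+ e ℚ.+ e) ≡ a ℚ.+ δ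
  split = solve 2 (λ a δ → let e = con sixth :* δ in
    a :+ (e :+ e :+ e) :+ (e :+ e :+ e) := a :+ δ) refl
  modulus : ℝ → ℕ
  modulus t = proj₁ (cauchy t e 0<e)
  M = N ℕ.⊔ modulus x ℕ.⊔ (modulus y ℕ.⊔ modulus z)
  ≤M₀ : N ℕ.≤ M
  ≤M₀ = ℕ.≤-trans (ℕ.m≤m⊔n N _) (ℕ.m≤m⊔n _ _)
  ≤M₁ : modulus x ℕ.≤ M
  ≤M₁ = ℕ.≤-trans (ℕ.m≤n⊔m N _) (ℕ.m≤m⊔n _ _)
  ≤M₂ : modulus y ℕ.≤ M
  ≤M₂ = ℕ.≤-trans (ℕ.m≤m⊔n _ _) (ℕ.m≤n⊔m (N ℕ.⊔ modulus x) _)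
  ≤M₃ : modulus z ℕ.≤ M
  ≤M₃ = ℕ.≤-trans (ℕ.m≤n⊔m (modulus y) _) (ℕ.m≤n⊔m (N ℕ.⊔ modulus x) _)
  near : ∀ t → modulus t ℕ.≤ M → ∀ i j → M ℕ.≤ i → M ℕ.≤ j → seq t i ℚ.≤ seq t j ℚ.+ e
  near t t≤M i j M≤i M≤j = ℚ.≤-trans (p≤q+∣p-q∣ (seq t i) (seq t j))
    (ℚ.+-monoʳ-≤ (seq t j)
      (ℚ.<⇒≤ (proj₂ (cauchy t e 0<e) i j (ℕ.≤-trans t≤M M≤i) (ℕ.≤-trans t≤M M≤j))))
  above : ∀ t → modulus t ℕ.≤ M → ∀ k → M ℕ.≤ k → seq t k ℚ.≤ seq t M ℚ.+ e
  above t t≤M k M≤k = near t t≤M k M M≤k ℕ.≤-refl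
  below : ∀ t → modulus t ℕ.≤ M → ∀ k → M ℕ.≤ k → seq t M ℚ.≤ seq t k ℚ.+ e
  below t t≤M k M≤k = near t t≤M M k ℕ.≤-refl M≤k

<-≤-trans : ∀ x y z → x < y → y ≤ z → x < z
<-≤-trans x y z x<y y≤z = [ id , (λ z<y → contradiction z<y y≤z) ]′ (<-cotrans x y z x<y)

≤-<-trans : ∀ x y z → x ≤ y → y < z → x < z
≤-<-trans x y z x≤y y<z = [ (λ y<x → contradiction y<x x≤y) , id ]′ (<-cotrans y z x y<z)

<⇒≤ : ∀ x y → x < y → x ≤ y
<⇒≤ x y x<y y<x = <-irrefl x (<-trans x y x x<y y<x)

-- Minima of finite lists of reals.

<-⊓ : ∀ x y z → z < x → z < y → z < x ⊓ y
<-⊓ x y z (δ , 0<δ , M , h) (δ′ , 0<δ′ , N , h′) =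
  δ ℚ.⊓ δ′ , 0<⊓ , M ℕ.⊔ N , λ k k≥ → ℚ.⊓-glb
    (ℚ.≤-trans (ℚ.+-monoʳ-≤ (seq z k) (ℚ.p⊓q≤p δ δ′)) (h k (ℕ.m⊔n≤o⇒m≤o M N k≥)))
    (ℚ.≤-trans (ℚ.+-monoʳ-≤ (seq z k) (ℚ.p⊓q≤q δ δ′)) (h′ k (ℕ.m⊔n≤o⇒n≤o M N k≥)))
  where
  0<⊓ : 0ℚ ℚ.< δ ℚ.⊓ δ′
  0<⊓ with ℚ.⊓-sel δ δ′
  ... | inj₁ eq = subst (0ℚ ℚ.<_) (sym eq) 0<δ
  ... | inj₂ eq = subst (0ℚ ℚ.<_) (sym eq) 0<δ′

<-⊓⇒<ˡ : ∀ x y z → z < x ⊓ y → z < x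
<-⊓⇒<ˡ x y z (δ , 0<δ , N , h) = δ , 0<δ , N , λ k N≤k →
  ℚ.≤-trans (h k N≤k) (ℚ.p⊓q≤p (seq x k) (seq y k))

<-⊓⇒<ʳ : ∀ x y z → z < x ⊓ y → z < y
<-⊓⇒<ʳ x y z (δ , 0<δ , N , h) = δ , 0<δ , N , λ k N≤k →
  ℚ.≤-trans (h k N≤k) (ℚ.p⊓q≤q (seq x k) (seq y k))

Any≤⇒min≤ : ∀ y x xs → Any (_≤ y) (x ∷ xs) → min (x ∷ xs) ≤ y
Any≤⇒min≤ y x []        (here x≤y) = x≤y
Any≤⇒min≤ y x (x′ ∷ xs) (here x≤y) = x≤y ∘ <-⊓⇒<ˡ x (min (x′ ∷ xs)) y
Any≤⇒min≤ y x (x′ ∷ xs) (there h)  =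
  Any≤⇒min≤ y x′ xs h ∘ <-⊓⇒<ʳ x (min (x′ ∷ xs)) y

-- Locating an element below `y` would require deciding comparisons of reals, hence the double
-- negation. If the head exceeds `y`, the minimum of the tail cannot exceed `y` as well.
min≤⇒¬¬Any≤ : ∀ y x xs → min (x ∷ xs) ≤ y → ¬ ¬ Any (_≤ y) (x ∷ xs)
min≤⇒¬¬Any≤ y x []        h ¬any = ¬any (here h)
min≤⇒¬¬Any≤ y x (x′ ∷ xs) h ¬any = ¬any (here λ y<x →
  min≤⇒¬¬Any≤ y x′ xs (λ y<min → h (<-⊓ x (min (x′ ∷ xs)) y y<x y<min)) (¬any ∘ there))

-- The conclusion is a negation, so the doubly negated witness may be used; the same `a` then
-- witnesses the second bound.
min-map-mono : ∀ {A : Set} (g g′ : A → ℝ) y y′ x xs →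
  (∀ a → g a ≤ y → g′ a ≤ y′) →
  min (g x ∷ map g xs) ≤ y → min (g′ x ∷ map g′ xs) ≤ y′
min-map-mono g g′ y y′ x xs mono g≤y y′<min =
  min≤⇒¬¬Any≤ y (g x) (map g xs) g≤y λ any →
    Any≤⇒min≤ y′ (g′ x) (map g′ xs)
      (Any.map⁺ {xs = x ∷ xs} (Any.map (λ {a} → mono a) (Any.map⁻ {xs = x ∷ xs} any))) y′<min

⊎-Any⇒min-map≤ : ∀ {A : Set} (g : A → ℝ) y x xs →
  x ≤ y ⊎ Any (λ a → g a ≤ y) xs → min (x ∷ map g xs) ≤ y
⊎-Any⇒min-map≤ g y x xs (inj₁ x≤y) = Any≤⇒min≤ y x (map g xs) (here x≤y)
⊎-Any⇒min-map≤ g y x xs (inj₂ any) = Any≤⇒min≤ y x (map g xs) (there (Any.map⁺ any))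

-- Fractions with a fixed denominator.

module _ (n : ℕ) .{{_ : NonZero n}} where

  private
    -- Normalisation hides the numerator of `i / m`. The facts below are therefore shown for
    -- unnormalised fractions by cross-multiplication and carried back along this equivalence.
    toℚᵘ-/ : ∀ m .{{_ : NonZero m}} i → ℚ.toℚᵘ (i ℚ./ m) ℚᵘ.≃ i ℚᵘ./ m
    toℚᵘ-/ (suc d) i = ℚ.toℚᵘ-fromℚᵘ (i ℚᵘ./ suc d)

    /-homo-+ᵘ : ∀ m .{{_ : NonZero m}} i j →
      (i ℤ.+ j) ℚᵘ./ m ℚᵘ.≃ i ℚᵘ./ m ℚᵘ.+ j ℚᵘ./ m
    /-homo-+ᵘ m@(suc _) i j = ℚᵘ.*≡* (trans
      (cong ((i ℤ.+ j) ℤ.*_) (ℤ.pos-* m m))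
      (ℤS.solve 3 (λ i j m → (i ℤS.:+ j) ℤS.:* (m ℤS.:* m) ℤS.:=
                             (i ℤS.:* m ℤS.:+ j ℤS.:* m) ℤS.:* m) refl i j (+ m)))
      where module ℤS = ℤ-Solver.+-*-Solver

    /-cancel-*ᵘ : ∀ m .{{_ : NonZero m}} i → (+ m ℤ.* i) ℚᵘ./ m ℚᵘ.≃ i ℚᵘ./ 1
    /-cancel-*ᵘ m@(suc _) i = ℚᵘ.*≡* (trans (ℤ.*-identityʳ _) (ℤ.*-comm (+ m) i))

    /-mono-≤ᵘ : ∀ m .{{_ : NonZero m}} {i j} → i ℤ.≤ j → i ℚᵘ./ m ℚᵘ.≤ j ℚᵘ./ m
    /-mono-≤ᵘ m@(suc _) i≤j = ℚᵘ.*≤* (ℤ.*-monoʳ-≤-nonNeg (+ m) i≤j)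

    /-cancel-<ᵘ : ∀ m .{{_ : NonZero m}} {i j} → i ℚᵘ./ m ℚᵘ.< j ℚᵘ./ m → i ℤ.< j
    /-cancel-<ᵘ m@(suc _) {i} {j} (ℚᵘ.*<* h) = ℤ.*-cancelʳ-<-nonNeg {i} {j} (+ m) h

  /-homo-+ : ∀ i j → (i ℤ.+ j) ℚ./ n ≡ i ℚ./ n ℚ.+ j ℚ./ n
  /-homo-+ i j = ℚ.toℚᵘ-injective (begin
    ℚ.toℚᵘ ((i ℤ.+ j) ℚ./ n)                 ≈⟨ toℚᵘ-/ n (i ℤ.+ j) ⟩
    (i ℤ.+ j) ℚᵘ./ n                         ≈⟨ /-homo-+ᵘ n i j ⟩
    i ℚᵘ./ n ℚᵘ.+ j ℚᵘ./ n                   ≈⟨ ℚᵘ.+-cong (toℚᵘ-/ n i) (toℚᵘ-/ n j) ⟨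
    ℚ.toℚᵘ (i ℚ./ n) ℚᵘ.+ ℚ.toℚᵘ (j ℚ./ n)   ≈⟨ ℚ.toℚᵘ-homo-+ (i ℚ./ n) (j ℚ./ n) ⟨
    ℚ.toℚᵘ (i ℚ./ n ℚ.+ j ℚ./ n)             ∎)
    where open ℚᵘ.≃-Reasoning

  /-cancel-* : ∀ i → (+ n ℤ.* i) ℚ./ n ≡ i ℚ./ 1
  /-cancel-* i = ℚ.toℚᵘ-injective (ℚᵘ.≃-trans (toℚᵘ-/ n (+ n ℤ.* i))
    (ℚᵘ.≃-trans (/-cancel-*ᵘ n i) (ℚᵘ.≃-sym (toℚᵘ-/ 1 i))))

  /-mono-≤ : ∀ {i j} → i ℤ.≤ j → i ℚ./ n ℚ.≤ j ℚ./ n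
  /-mono-≤ {i} {j} i≤j = ℚ.toℚᵘ-cancel-≤
    (ℚᵘ.≤-respˡ-≃ (ℚᵘ.≃-sym (toℚᵘ-/ n i))
      (ℚᵘ.≤-respʳ-≃ (ℚᵘ.≃-sym (toℚᵘ-/ n j)) (/-mono-≤ᵘ n i≤j)))

  /-cancel-< : ∀ {i j} → i ℚ./ n ℚ.< j ℚ./ n → i ℤ.< j
  /-cancel-< {i} {j} h = /-cancel-<ᵘ n
    (ℚᵘ.<-respˡ-≃ (toℚᵘ-/ n i) (ℚᵘ.<-respʳ-≃ (toℚᵘ-/ n j) (ℚ.toℚᵘ-mono-< h)))

-- Termwise comparison, the Archimedean property and floors.

≤-pointwise : ∀ x y → (∀ k → seq x k ℚ.≤ seq y k) → x ≤ y
≤-pointwise x y x≤y y<x = <-irrefl y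
  (<-by-difference y x y y (λ k → ℚ.+-monoˡ-≤ (ℚ.- seq y k) (x≤y k)) y<x)

-- The denominator is at least 1.
≤∣↥∣ : ∀ q → q ℚ.≤ + ℤ.∣ ℚ.↥ q ∣ ℚ./ 1
≤∣↥∣ q@(mkℚ i d _) = ℚ.toℚᵘ-cancel-≤ (ℚᵘ.≤-respʳ-≃
  (ℚᵘ.≃-sym (ℚ.toℚᵘ-fromℚᵘ (+ ℤ.∣ i ∣ ℚᵘ./ 1)))
  (ℚᵘ.*≤* (ℤ.≤-trans (ℤ.≤-reflexive (ℤ.*-identityʳ i)) (≤∣i∣*m i d))))
  where
  ≤∣i∣*m : ∀ i d → i ℤ.≤ + ℤ.∣ i ∣ ℤ.* + suc d
  ≤∣i∣*m (+ m) d = subst (+ m ℤ.≤_) (ℤ.pos-* m (suc d)) (ℤ.+≤+ (ℕ.m≤m*n m (suc d)))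
  ≤∣i∣*m ℤ.-[1+ m ] d = subst (ℤ.-[1+ m ] ℤ.≤_) (ℤ.pos-* (suc m) (suc d)) ℤ.-≤+

archimedean : ∀ x → ∃[ m ] x < fromℤ (+ m)
archimedean x = m , 1ℚ , 0<1 , N , λ k N≤k → let open ℚ.≤-Reasoning in begin
  seq x k ℚ.+ 1ℚ                            ≤⟨ ℚ.+-monoˡ-≤ 1ℚ (p≤q+∣p-q∣ (seq x k) (seq x N)) ⟩
  seq x N ℚ.+ ∣ seq x k ℚ.- seq x N ∣ ℚ.+ 1ℚ ≤⟨ ℚ.+-monoˡ-≤ 1ℚ (ℚ.+-mono-≤ (≤∣↥∣ (seq x N))
                                                  (ℚ.<⇒≤ (near k N N≤k ℕ.≤-refl))) ⟩
  (+ b ℚ./ 1) ℚ.+ 1ℚ ℚ.+ 1ℚ                 ≡⟨ cong (ℚ._+ 1ℚ) (/-homo-+ 1 (+ b) 1ℤ) ⟨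
  ((+ b ℤ.+ 1ℤ) ℚ./ 1) ℚ.+ 1ℚ               ≡⟨ /-homo-+ 1 (+ b ℤ.+ 1ℤ) 1ℤ ⟨
  + m ℚ./ 1                                 ∎
  where
  0<1 : 0ℚ ℚ.< 1ℚ
  0<1 = ℚ.positive⁻¹ 1ℚ
  N = proj₁ (cauchy x 1ℚ 0<1)
  near = proj₂ (cauchy x 1ℚ 0<1)
  b = ℤ.∣ ℚ.↥ (seq x N) ∣
  -- One unit covers the drift of the terms past `N`, the other is the margin `δ = 1` of the strict
  -- inequality.
  m = b ℕ.+ 1 ℕ.+ 1

IsFloor : ℝ → ℤ → Set
IsFloor x z = fromℤ z ≤ x × x < fromℤ (1ℤ ℤ.+ z)

private
  -- Upward search through `k` unit intervals starting at `z`. Each test `x < 1 + z` is settled by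
  -- excluded middle under double negation, and at `k = 0` the two bounds contradict each other.
  floor-between : ∀ x k z → fromℤ z ≤ x → x < fromℤ (+ k ℤ.+ z) → ¬ ¬ ∃ (IsFloor x)
  floor-between x zero    z z≤x x<z _ = z≤x (subst (λ i → x < fromℤ i) (ℤ.+-identityˡ z) x<z)
  floor-between x (suc k) z z≤x x<z ¬f = ¬¬-excluded-middle λ where
    (yes x<1+z) → ¬f (z , z≤x , x<1+z)
    (no  1+z≤x) → floor-between x k (1ℤ ℤ.+ z) 1+z≤x
      (subst (λ i → x < fromℤ i)
        (trans (cong (ℤ._+ z) (ℤ.+-comm 1ℤ (+ k))) (ℤ.+-assoc (+ k) 1ℤ z)) x<z) ¬f

¬¬floor : ∀ x → ¬ ¬ ∃ (IsFloor x)
¬¬floor x = floor-between x (m ℕ.+ k) (ℤ.- + k) -k≤x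
  (subst (λ i → x < fromℤ i) (sym m+k-k≡m) x<m)
  where
  m = proj₁ (archimedean x)
  k = proj₁ (archimedean (- x))
  x<m = proj₂ (archimedean x)
  m+k-k≡m : + (m ℕ.+ k) ℤ.+ ℤ.- + k ≡ + m
  m+k-k≡m = trans (ℤ.+-assoc (+ m) (+ k) (ℤ.- + k))
    (trans (cong (ℤ._+_ (+ m)) (ℤ.+-inverseʳ (+ k))) (ℤ.+-identityʳ (+ m)))
  -k/1 : (ℤ.- + k) ℚ./ 1 ≡ ℚ.- (+ k ℚ./ 1)
  -k/1 = inverseˡ-unique _ _
    (trans (sym (/-homo-+ 1 (ℤ.- + k) (+ k))) (cong (ℚ._/ 1) (ℤ.+-inverseˡ (+ k))))
  -k≤x : fromℤ (ℤ.- + k) ≤ x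
  -k≤x = <⇒≤ (fromℤ (ℤ.- + k)) x (<-≡-difference (- x) (fromℤ (+ k)) (fromℤ (ℤ.- + k)) x
    (λ j → trans (solve 2 (λ k x → k :- (:- x) := x :- (:- k)) refl (+ k ℚ./ 1) (seq x j))
                 (cong (λ q → seq x j ℚ.- q) (sym -k/1)))
    (proj₂ (archimedean (- x))))

-- Otherwise `1 + z′ + w ≤ z`, whence `y + w < z ≤ x`, against `x - w ≤ y`.
floor-shift : ∀ x y w {z z′} → IsFloor x z → IsFloor y z′ →
  x - fromℤ w ≤ y → z ℤ.≤ z′ ℤ.+ w
floor-shift x y w {z} {z′} (z≤x , _) (_ , y<1+z′) x-w≤y = ℤ.≮⇒≥ λ z′+w<z →
  x-w≤y (<-≡-difference (y + fromℤ w) x y (x - fromℤ w)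
    (λ k → solve 3 (λ x y w → x :- (y :+ w) := x :- w :- y) refl (seq x k) (seq y k) (w ℚ./ 1))
    (<-≤-trans (y + fromℤ w) (fromℤ z) x
      (<-by-difference y (fromℤ (1ℤ ℤ.+ z′)) (y + fromℤ w) (fromℤ z)
        (λ k → ℚ.≤-trans
          (ℚ.≤-reflexive (solve 3 (λ u y w → u :- y := u :+ w :- (y :+ w)) refl
            ((1ℤ ℤ.+ z′) ℚ./ 1) (seq y k) (w ℚ./ 1)))
          (ℚ.+-monoˡ-≤ (ℚ.- (seq y k ℚ.+ w ℚ./ 1)) (1+z′+w≤z z′+w<z)))
        y<1+z′)
      z≤x))
  where
  1+z′+w≤z : z′ ℤ.+ w ℤ.< z → (1ℤ ℤ.+ z′) ℚ./ 1 ℚ.+ w ℚ./ 1 ℚ.≤ z ℚ./ 1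
  1+z′+w≤z h = subst (ℚ._≤ z ℚ./ 1) (/-homo-+ 1 (1ℤ ℤ.+ z′) w)
    (/-mono-≤ 1 (subst (ℤ._≤ z) (sym (ℤ.+-assoc 1ℤ z′ w)) (ℤ.i<j⇒suc[i]≤j h)))

floor-x-x-nonneg : ∀ x {z} → IsFloor (x - x) z → 0ℤ ℤ.≤ z
floor-x-x-nonneg x {z} (_ , x-x<1+z) = ℤ.≮⇒≥ λ z<0 →
  ℤ.<⇒≱ (/-cancel-< 1 (fromℚ-cancel-<
    (<-≡-difference (x - x) (fromℤ (1ℤ ℤ.+ z)) 0ℝ (fromℤ (1ℤ ℤ.+ z))
      (λ k → cong (λ q → (1ℤ ℤ.+ z) ℚ./ 1 ℚ.- q) (ℚ.+-inverseʳ (seq x k)))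
      x-x<1+z)))
    (ℤ.i<j⇒suc[i]≤j z<0)

floor-neg : ∀ x y {z} → x < y → IsFloor (x - y) z → z ℤ.< 0ℤ
floor-neg x y {z} x<y (z≤x-y , _) = /-cancel-< 1 (fromℚ-cancel-<
  (≤-<-trans (fromℤ z) (x - y) 0ℝ z≤x-y
    (<-≡-difference x y (x - y) 0ℝ
      (λ k → solve 2 (λ x y → y :- x := con 0ℚ :- (x :- y)) refl (seq x k) (seq y k)) x<y)))

-- Sums of integer vectors.

sum-shift : ∀ {n} (f g : Vector ℤ n) w → (∀ i → f i ℤ.≤ g i ℤ.+ w) →
  sum f ℤ.≤ sum g ℤ.+ + n ℤ.* w
sum-shift {zero}  f g w f≤g = ℤ.≤-refl
sum-shift {suc n} f g w f≤g =
  ℤ.≤-trans (ℤ.+-mono-≤ (f≤g zero) (sum-shift (tail f) (tail g) w (f≤g ∘ suc)))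
    (ℤ.≤-reflexive (ℤS.solve 4 (λ g G w n → g ℤS.:+ w ℤS.:+ (G ℤS.:+ n ℤS.:* w) ℤS.:=
      g ℤS.:+ G ℤS.:+ (ℤS.con 1ℤ ℤS.:+ n) ℤS.:* w) refl (head g) (sum (tail g)) w (+ n)))
  where module ℤS = ℤ-Solver.+-*-Solver

sum-mono-≤ : ∀ {n} (f g : Vector ℤ n) → (∀ i → f i ℤ.≤ g i) → sum f ℤ.≤ sum g
sum-mono-≤ {zero}  f g f≤g = ℤ.≤-refl
sum-mono-≤ {suc n} f g f≤g = ℤ.+-mono-≤ (f≤g zero) (sum-mono-≤ (tail f) (tail g) (f≤g ∘ suc))

sum-mono-< : ∀ {n} (f g : Vector ℤ n) → (∀ i → f i ℤ.≤ g i) →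
  ∀ j → f j ℤ.< g j → sum f ℤ.< sum g
sum-mono-< f g f≤g zero    f<g = ℤ.+-mono-<-≤ f<g (sum-mono-≤ (tail f) (tail g) (f≤g ∘ suc))
sum-mono-< f g f≤g (suc j) f<g =
  ℤ.+-mono-≤-< (f≤g zero) (sum-mono-< (tail f) (tail g) (f≤g ∘ suc) j f<g)

-- Double negation: finite families and suprema.

¬¬floors : ∀ {n} (a : Fin n → ℝ) → ¬ ¬ (∀ i j → ∃ (IsFloor (a i - a j)))
¬¬floors {n} a = sequence ¬¬-applicative {P = λ i → ∀ j → ∃ (IsFloor (a i - a j))} λ i →
  sequence ¬¬-applicative {P = λ j → ∃ (IsFloor (a i - a j))} λ j → ¬¬floor (a i - a j)
  where ¬¬-applicative = RawMonad.rawApplicative ¬¬-Monad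

-- For real `e` the bound is a negation, so `¬ ¬ S x` suffices; `⊥±` is refuted by any element of
-- `S`, and `⊤±` bounds everything.
¬¬∈⇒≤supremum : ∀ (S : Pred ℝ _) e x → IsSupremum S e → ¬ ¬ S x → [ x ] ≤± e
¬¬∈⇒≤supremum S ⊥±    x (upper , _) ¬¬Sx =
  contradiction (λ Sx → [x]≰⊥± (upper x Sx)) ¬¬Sx
  where
  [x]≰⊥± : ¬ ([ x ] ≤± ⊥±)
  [x]≰⊥± (Sup.[ () ])
¬¬∈⇒≤supremum S [ y ] x (upper , _) ¬¬Sx =
  [ (λ y<x → ¬¬Sx λ Sx → [≤]-injective (upper x Sx) y<x) ]
¬¬∈⇒≤supremum S ⊤±    x _ _ = [ x ]≤⊤±

-- Rounding a finite family of reals.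

module Rounding {N : ℕ} .{{_ : NonZero N}} (a : Fin N → ℝ) (f : Fin N → Fin N → ℤ)
                (isFloor : ∀ i j → IsFloor (a i - a j) (f i j)) where

  rounded : Fin N → ℝ
  rounded i = fromℚ (sum (f i) ℚ./ N)

  private
    -- Subtracting the common `a j` from both times leaves the hypothesis unchanged, so
    -- `floor-shift` applies for each `j`.
    f-shift : ∀ i l w → a l - fromℤ w ≤ a i → ∀ j → f l j ℤ.≤ f i j ℤ.+ w
    f-shift i l w h j = floor-shift (a l - a j) (a i - a j) w {z′ = f i j} (isFloor l j) (isFloor i j)
      (h ∘ <-≡-difference (a i - a j) (a l - a j - fromℤ w) (a i) (a l - fromℤ w)
        (λ k → solve 4 (λ ai al aj w → al :- aj :- w :- (ai :- aj) := al :- w :- ai) refl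
                 (seq (a i) k) (seq (a l) k) (seq (a j) k) (w ℚ./ 1)))

  -- Each of the `N` summands obeys the bound with shift `w`, so the sums obey it with `N * w` and
  -- the averages again with `w`.
  rounded-shift : ∀ i l w → a l - fromℤ w ≤ a i → rounded l - fromℤ w ≤ rounded i
  rounded-shift i l w h = ≤-pointwise (rounded l - fromℤ w) (rounded i) λ _ → begin
    sum (f l) ℚ./ N ℚ.- w ℚ./ 1
      ≤⟨ ℚ.+-monoˡ-≤ (ℚ.- (w ℚ./ 1)) (/-mono-≤ N (sum-shift (f l) (f i) w (f-shift i l w h))) ⟩
    (sum (f i) ℤ.+ + N ℤ.* w) ℚ./ N ℚ.- w ℚ./ 1
      ≡⟨ cong (ℚ._- w ℚ./ 1) (trans (/-homo-+ N (sum (f i)) (+ N ℤ.* w))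
                                    (cong (sum (f i) ℚ./ N ℚ.+_) (/-cancel-* N w))) ⟩
    sum (f i) ℚ./ N ℚ.+ w ℚ./ 1 ℚ.- w ℚ./ 1
      ≡⟨ solve 2 (λ p q → p :+ q :- q := p) refl (sum (f i) ℚ./ N) (w ℚ./ 1) ⟩
    sum (f i) ℚ./ N ∎
    where open ℚ.≤-Reasoning

  private
    f-mono-≤ : ∀ i l → a l ≤ a i → ∀ j → f l j ℤ.≤ f i j
    f-mono-≤ i l h j = subst (f l j ℤ.≤_) (ℤ.+-identityʳ (f i j)) (f-shift i l 0ℤ
      (h ∘ <-≡-difference (a i) (a l - fromℤ 0ℤ) (a i) (a l)
        (λ k → cong (ℚ._- seq (a i) k) (ℚ.+-identityʳ (seq (a l) k)))) j)

  rounded-mono-≤ : ∀ i l → a l ≤ a i → rounded l ≤ rounded i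
  rounded-mono-≤ i l h = ≤-pointwise (rounded l) (rounded i)
    λ _ → /-mono-≤ N (sum-mono-≤ (f l) (f i) (f-mono-≤ i l h))

  -- The sums are integers, so a strict inequality between them is a gap of at least 1, which
  -- becomes `1/N` after division.
  rounded-gap : ∀ i l → a i < a l → rounded i + fromℚ (1ℤ ℚ./ N) ≤ rounded l
  rounded-gap i l h = ≤-pointwise (rounded i + fromℚ (1ℤ ℚ./ N)) (rounded l) λ _ →
    subst (ℚ._≤ sum (f l) ℚ./ N) (/-homo-+ N (sum (f i)) 1ℤ)
      (/-mono-≤ N (subst (ℤ._≤ sum (f l)) (ℤ.+-comm 1ℤ (sum (f i))) (ℤ.i<j⇒suc[i]≤j
        (sum-mono-< (f i) (f l) (f-mono-≤ l i (<⇒≤ (a i) (a l) h)) l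
          -- The summand at `j = l` is the strict one: `f i l < 0 ≤ f l l`.
          (ℤ.<-≤-trans (floor-neg (a i) (a l) h (isFloor i l))
                       (floor-x-x-nonneg (a l) (isFloor l l)))))))

-- Membership is stated through `proj₁` because the list carries the proof of `Q x` produced by
-- `Q?`, not the given one.
select⁺ : ∀ {a q} {A : Set a} {Q : Pred A q} (Q? : Decidable Q) {x xs} →
  x ∈ˡ xs → Q x → Any ((x ≡_) ∘ proj₁) (select Q? xs)
select⁺ Q? {x} {y ∷ ys} x∈ qx with Q? y | x∈
... | yes _  | here refl = here refl
... | yes _  | there x∈′ = there (select⁺ Q? x∈′ qx)
... | no ¬qx | here refl = contradiction qx ¬qx
... | no _   | there x∈′ = select⁺ Q? x∈′ qx

-- Rounding a viable and dynamic strategy.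

module _ {n p} .{{_ : NonZero n}} (Γ : CHyTN n p) where
  open CHyTN Γ
  open HyperConstraint

  private
    N : ℕ
    N = 2 ^ p ℕ.* n

    instance
      N≢0 : NonZero N
      N≢0 = ℕ.m*n≢0 (2 ^ p) n {{ℕ.m^n≢0 2 p}}

    -- All scenarios share one index set, so that rounding also preserves comparisons between times
    -- in different scenarios.
    index : (Scenario p × Fin n) ↔ Fin N
    index = ↔-trans (Scenario↔Fin p ×-↔ ↔-id (Fin n)) (↔-sym *↔×)

    at : Scenario p → Fin n → Fin N
    at s v = Inverse.to index (s , v)

  Δ⁺ : ∀ s₁ s₂ x → _∈V⁺_ Γ (obs x) s₁ → ¬ (lookup s₁ x ≡ lookup s₂ x) →
    Any ((obs x ≡_) ∘ proj₁) (Δ Γ s₁ s₂)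
  Δ⁺ s₁ s₂ x o s₁≢s₂ = Any.map⁺ (Any.map (cong obs) (select⁺
    (λ x → T? (s₁ ⟦ L (obs x) ⟧) ×-dec ¬? (lookup s₁ x Bool.≟ lookup s₂ x)) (∈-allFin x) (o , s₁≢s₂)))

  private module _ (σ : Strategy Γ) where

    extend : (e : Scenario p × Fin n) → ℝ
    extend (s , v) with T? (s ⟦ L v ⟧)
    ... | yes v∈ = σ s (v , v∈)
    -- This default enters the averages of executed events only as a subtracted `a j`; the bounds on
    -- `σ′` compare executed events alone.
    ... | no _   = 0ℝ

    extend-≡ : ∀ s v (v∈ : _∈V⁺_ Γ v s) → extend (s , v) ≡ σ s (v , v∈)
    extend-≡ s v v∈ with T? (s ⟦ L v ⟧)
    ... | yes v∈′ = cong (λ t → σ s (v , t)) (T-irrelevant v∈′ v∈)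
    ... | no v∉   = contradiction v∈ v∉

    time : Fin N → ℝ
    time = extend ∘ Inverse.from index

    time-≡ : ∀ s v (v∈ : _∈V⁺_ Γ v s) → time (at s v) ≡ σ s (v , v∈)
    time-≡ s v v∈ = trans (cong extend (Inverse.strictlyInverseʳ index (s , v))) (extend-≡ s v v∈)

    module _ (f : Fin N → Fin N → ℤ) (isFloor : ∀ i j → IsFloor (time i - time j) (f i j)) where

      open Rounding time f isFloor

      σ′ : Strategy Γ
      σ′ s (v , _) = rounded (at s v)

      σ′-shift : ∀ s u v w → σ s v - fromℤ w ≤ σ s u → σ′ s v - fromℤ w ≤ σ′ s u
      σ′-shift s (u , u∈) (v , v∈) w h = rounded-shift (at s u) (at s v) w
        (subst₂ (λ y x → y - fromℤ w ≤ x) (sym (time-≡ s v v∈)) (sym (time-≡ s u u∈)) h)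

      σ′-mono-≤ : ∀ s₁ s₂ u v → σ s₁ u ≤ σ s₂ v → σ′ s₁ u ≤ σ′ s₂ v
      σ′-mono-≤ s₁ s₂ (u , u∈) (v , v∈) h = rounded-mono-≤ (at s₂ v) (at s₁ u)
        (subst₂ _≤_ (sym (time-≡ s₁ u u∈)) (sym (time-≡ s₂ v v∈)) h)

      σ′-gap : ∀ s u v → σ s u < σ s v → σ′ s u + 1/[∣Σ∣*∣V∣] n p ≤ σ′ s v
      σ′-gap s (u , u∈) (v , v∈) h = rounded-gap (at s u) (at s v)
        (subst₂ _<_ (sym (time-≡ s u u∈)) (sym (time-≡ s v v∈)) h)

      -- Weights are integers, so the inequality for each single head survives rounding, and with it
      -- the bound on the minimum.
      viable′ : Viable Γ σ → Viable Γ σ′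
      viable′ viable s {A} A∈ {h} {hs} eq =
        min-map-mono (cost σ) (cost σ′) (σ s tailA) (σ′ s tailA) h hs
          (λ a → σ′-shift s tailA (head⁺ Γ A∈ a) (weight A (proj₂ (proj₁ a))))
          (viable s A∈ eq)
        where
        tailA : V⁺ Γ s
        tailA = tail⁺ Γ A∈ h
        cost : Strategy Γ → ActiveHead Γ A s → ℝ
        cost τ a = τ s (head⁺ Γ A∈ a) - fromℤ (weight A (proj₂ (proj₁ a)))

      -- Suppose `σ′ s₁ u` lies below the minimum. An observation in `Δ` preceding `u` under `σ s₁`
      -- would, by the gap, contribute an entry at most `σ′ s₁ u`; so there is none and `s₂` agrees
      -- with the history of `u`. Dynamicity then gives equal times of `u`, and the entry `σ′ s₂ u`
      -- contradicts the assumption.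
      εDynamic : Dynamic Γ σ → EpsilonDynamic Γ (1/[∣Σ∣*∣V∣] n p) σ′
      εDynamic dynamic s₁ s₂ u u₁ u₂ u<min = bound
        (inj₁ (σ′-mono-≤ s₂ s₁ (u , u₂) (u , u₁) (proj₂ (dynamic s₁ s₂ u u₁ u₂ agrees))))
        u<min
        where
        after : V⁺ Γ s₁ → ℝ
        after v = σ′ s₁ v + 1/[∣Σ∣*∣V∣] n p
        bound : σ′ s₂ (u , u₂) ≤ σ′ s₁ (u , u₁) ⊎
                Any (λ v → after v ≤ σ′ s₁ (u , u₁)) (Δ Γ s₁ s₂) →
                min (σ′ s₂ (u , u₂) ∷ map after (Δ Γ s₁ s₂)) ≤ σ′ s₁ (u , u₁)
        bound = ⊎-Any⇒min-map≤ after (σ′ s₁ (u , u₁)) (σ′ s₂ (u , u₂)) (Δ Γ s₁ s₂)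
        late : ∀ x (o : _∈V⁺_ Γ (obs x) s₁) → σ s₁ (obs x , o) < σ s₁ (u , u₁) →
               ∀ {v} → obs x ≡ proj₁ v → after v ≤ σ′ s₁ (u , u₁)
        late x o obs<u {_ , o′} refl = σ′-gap s₁ (obs x , o′) (u , u₁)
          -- The entry of `Δ` has its own proof that `obs x` is executed; such proofs are unique.
          (subst (λ t → σ s₁ (obs x , t) < σ s₁ (u , u₁)) (T-irrelevant o o′) obs<u)
        agrees : Con Γ (scHst Γ {s₁} (u , u₁) σ) s₂
        agrees x b (b≡ , o , obs<u) = trans
          -- Equality of booleans is decidable, so it suffices to refute disagreement, which would
          -- put `obs x` into `Δ`.
          (decidable-stable (lookup s₂ x Bool.≟ lookup s₁ x) λ s₂≢s₁ →
            bound (inj₂ (Any.map (λ {v} → late x o obs<u {v}) (Δ⁺ s₁ s₂ x o (s₂≢s₁ ∘ sym))))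
                  u<min)
          (sym b≡)

  ¬¬ε-dynamicallyConsistent : DynamicallyConsistent Γ →
    ¬ ¬ EpsilonDynamicallyConsistent Γ (1/[∣Σ∣*∣V∣] n p)
  ¬¬ε-dynamicallyConsistent (σ , viable , dynamic) = ¬¬-map rounding (¬¬floors (time σ))
    where
    rounding : (∀ i j → ∃ (IsFloor (time σ i - time σ j))) →
               EpsilonDynamicallyConsistent Γ (1/[∣Σ∣*∣V∣] n p)
    rounding floors = σ′ σ f isFloor , viable′ σ f isFloor viable , εDynamic σ f isFloor dynamic
      where
      f : Fin N → Fin N → ℤ
      f i j = proj₁ (floors i j)
      isFloor : ∀ i j → IsFloor (time σ i - time σ j) (f i j)
      isFloor i j = proj₂ (floors i j)

  0<1/N : 0ℝ < 1/[∣Σ∣*∣V∣] n p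
  0<1/N = fromℚ-mono-< (ℚ.positive⁻¹ (1ℤ ℚ./ N) {{ℚ.normalize-pos 1 N}})

  ¬¬ε-dynamicallyConsistent⇒≤reactionTime : ∀ {ε} ε̂ → 0ℝ < ε →
    ¬ ¬ EpsilonDynamicallyConsistent Γ ε → IsReactionTime Γ ε̂ → [ ε ] ≤± ε̂
  ¬¬ε-dynamicallyConsistent⇒≤reactionTime {ε} ε̂ 0<ε ¬¬edc sup =
    ¬¬∈⇒≤supremum (λ ε → 0ℝ < ε × EpsilonDynamicallyConsistent Γ ε) ε̂ ε sup (¬¬-map (0<ε ,_) ¬¬edc)

theorem8 : (n p : ℕ) .{{_ : NonZero n}} (Γ : CHyTN n p) →
    DynamicallyConsistent Γ →
    (ε̂ : ℝ ±) → IsReactionTime Γ ε̂ →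
    [ 1/[∣Σ∣*∣V∣] n p ] ≤± ε̂
theorem8 n p Γ dc ε̂ = ¬¬ε-dynamicallyConsistent⇒≤reactionTime Γ ε̂
  (0<1/N Γ) (¬¬ε-dynamicallyConsistent Γ dc)
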